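{- Let $(G_m)_{m\in\mathbb{Z}}$ be a generalized Fibonacci sequence and let $n\ge 0$ be an integer. Then $$\begin{aligned} \sum_{k=0}^n (-1)^k k^2 G_k G_{n-k} = {}& (-1)^n \frac{1}{2} n \left\{ \left[ (n-1) G_0 - (n+1) G_1 \right] G_n + \left[ (n-1) G_0 + 2 G_1 \right] G_{n+1} \right\} \\ & - \left(1+(-1)^n\right) \left( G_1 G_n - G_0 G_{n+1} \right). \end{aligned}$$
   Context: A generalized Fibonacci sequence is a sequence $(G_m)_{m\in\mathbb{Z}}$ of complex numbers with $G_{m+2}=G_{m+1}+G_m$ for all integers $m$ (with arbitrary seed $G_0,G_1$). -}

module Defs where

open import Algebra.Bundles using (CommutativeRing)
import Algebra.Properties.Monoid.Mult as MonoidMult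
import Algebra.Properties.Monoid.Sum as MonoidSum
import Algebra.Properties.Ring as RingProperties
import Algebra.Properties.Semiring.Exp as SemiringExp
import Algebra.Solver.Ring.NaturalCoefficients.Default as SemiringSolver
open import Data.Integer.Base as ℤ using (ℤ)
open import Data.Nat.Base as ℕ using (ℕ)
import Data.Nat.Properties as ℕ
open import Data.Product.Base using (∃-syntax; _×_; _,_)
open import Data.Rational.Base as ℚ using (ℚ; 0ℚ; 1ℚ; ½; ∣_∣)
import Data.Rational.Properties as ℚ
open import Data.Rational.Solver using (module +-*-Solver)
open import Level using (0ℓ)
open import Relation.Binary.PropositionalEquality
  using (_≡_; refl; sym; trans; cong; subst)

------------------------------------------------------------------------
-- Real numbers: Cauchy sequences of rationals, two sequences being equal
-- when their difference tends to 0.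

record ℝ : Set where
  constructor mkℝ
  field
    seq    : ℕ → ℚ
    cauchy : ∀ ε → 0ℚ ℚ.< ε →
             ∃[ N ] (∀ m n → N ℕ.≤ m → N ℕ.≤ n → ∣ seq m ℚ.- seq n ∣ ℚ.< ε)

open ℝ public

-- A record rather than a function, so that x and y can be inferred.
infix 4 _≃_
record _≃_ (x y : ℝ) : Set where
  constructor mk≃
  field
    close : ∀ ε → 0ℚ ℚ.< ε →
            ∃[ N ] (∀ n → N ℕ.≤ n → ∣ seq x n ℚ.- seq y n ∣ ℚ.< ε)

open _≃_ public

private
  -- Each operation on ℝ acts termwise; these estimates show that it
  -- preserves Cauchy sequences and respects _≃_.

  half-pos : ∀ {ε} → 0ℚ ℚ.< ε → 0ℚ ℚ.< ε ℚ.* ½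
  half-pos {ε} ε>0 = ℚ.positive⁻¹ (ε ℚ.* ½)
    {{ℚ.pos*pos⇒pos ε {{ℚ.positive ε>0}} ½}}

  halves : ∀ ε → ε ℚ.* ½ ℚ.+ ε ℚ.* ½ ≡ ε
  halves ε = trans (sym (ℚ.*-distribˡ-+ ε ½ ½)) (ℚ.*-identityʳ ε)

  ∣p-p∣≡0 : ∀ p → ∣ p ℚ.- p ∣ ≡ 0ℚ
  ∣p-p∣≡0 p = cong ∣_∣ (ℚ.+-inverseʳ p)

  ∣p-q∣≡∣q-p∣ : ∀ p q → ∣ p ℚ.- q ∣ ≡ ∣ q ℚ.- p ∣
  ∣p-q∣≡∣q-p∣ p q = trans (sym (ℚ.∣-p∣≡∣p∣ (p ℚ.- q)))
    (cong ∣_∣ (solve 2 (λ p q → :- (p :- q) := q :- p) refl p q))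
    where open +-*-Solver

  sum-small : ∀ p q ε → ∣ p ∣ ℚ.< ε ℚ.* ½ → ∣ q ∣ ℚ.< ε ℚ.* ½ →
              ∣ p ℚ.+ q ∣ ℚ.< ε
  sum-small p q ε p<ε/2 q<ε/2 = subst (∣ p ℚ.+ q ∣ ℚ.<_) (halves ε)
    (ℚ.≤-<-trans (ℚ.∣p+q∣≤∣p∣+∣q∣ p q) (ℚ.+-mono-< p<ε/2 q<ε/2))

  +-estimate : ∀ a b c d ε →
               ∣ a ℚ.- c ∣ ℚ.< ε ℚ.* ½ → ∣ b ℚ.- d ∣ ℚ.< ε ℚ.* ½ →
               ∣ (a ℚ.+ b) ℚ.- (c ℚ.+ d) ∣ ℚ.< ε
  +-estimate a b c d ε ac bd = subst (λ p → ∣ p ∣ ℚ.< ε)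
    (solve 4 (λ a b c d → (a :- c) :+ (b :- d) := (a :+ b) :- (c :+ d))
      refl a b c d)
    (sum-small (a ℚ.- c) (b ℚ.- d) ε ac bd)
    where open +-*-Solver

  -‿estimate : ∀ a b ε → ∣ a ℚ.- b ∣ ℚ.< ε → ∣ (ℚ.- a) ℚ.- (ℚ.- b) ∣ ℚ.< ε
  -‿estimate a b ε ab = subst (ℚ._< ε)
    (trans (∣p-q∣≡∣q-p∣ a b)
      (cong ∣_∣ (solve 2 (λ a b → b :- a := (:- a) :- (:- b)) refl a b)))
    ab
    where open +-*-Solver

  module _ (B : ℚ) (B>0 : 0ℚ ℚ.< B) where
    instance
      _ : ℚ.Positive B
      _ = ℚ.positive B>0

      _ : ℚ.NonZero B
      _ = ℚ.pos⇒nonZero B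

    scale : ℚ → ℚ
    scale ε = ℚ.1/ B ℚ.* (ε ℚ.* ½)

    scale-pos : ∀ {ε} → 0ℚ ℚ.< ε → 0ℚ ℚ.< scale ε
    scale-pos {ε} ε>0 = ℚ.positive⁻¹ (scale ε)
      {{ℚ.pos*pos⇒pos (ℚ.1/ B) {{ℚ.1/pos⇒pos B}}
        (ε ℚ.* ½) {{ℚ.positive (half-pos ε>0)}}}}

    B*scale : ∀ ε → B ℚ.* scale ε ≡ ε ℚ.* ½
    B*scale ε = trans (sym (ℚ.*-assoc B (ℚ.1/ B) (ε ℚ.* ½)))
      (trans (cong (ℚ._* (ε ℚ.* ½)) (ℚ.*-inverseʳ B))
        (ℚ.*-identityˡ (ε ℚ.* ½)))

    product-small : ∀ p q ε → ∣ p ∣ ℚ.≤ B → ∣ q ∣ ℚ.< scale ε →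
                    ∣ p ℚ.* q ∣ ℚ.< ε ℚ.* ½
    product-small p q ε p≤B q<δ = begin-strict
      ∣ p ℚ.* q ∣      ≡⟨ ℚ.∣p*q∣≡∣p∣*∣q∣ p q ⟩
      ∣ p ∣ ℚ.* ∣ q ∣  ≤⟨ ℚ.*-monoʳ-≤-nonNeg ∣ q ∣ {{ℚ.∣-∣-nonNeg q}} p≤B ⟩
      B ℚ.* ∣ q ∣      <⟨ ℚ.*-monoʳ-<-pos B q<δ ⟩
      B ℚ.* scale ε    ≡⟨ B*scale ε ⟩
      ε ℚ.* ½          ∎
      where open ℚ.≤-Reasoning

    *-estimate : ∀ a b c d ε → ∣ a ∣ ℚ.≤ B → ∣ d ∣ ℚ.≤ B →
                 ∣ a ℚ.- c ∣ ℚ.< scale ε → ∣ b ℚ.- d ∣ ℚ.< scale ε →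
                 ∣ (a ℚ.* b) ℚ.- (c ℚ.* d) ∣ ℚ.< ε
    *-estimate a b c d ε a≤B d≤B ac bd = subst (λ p → ∣ p ∣ ℚ.< ε)
      (solve 4 (λ a b c d →
        a :* (b :- d) :+ d :* (a :- c) := (a :* b) :- (c :* d))
        refl a b c d)
      (sum-small (a ℚ.* (b ℚ.- d)) (d ℚ.* (a ℚ.- c)) ε
        (product-small a (b ℚ.- d) ε a≤B bd)
        (product-small d (a ℚ.- c) ε d≤B ac))
      where open +-*-Solver

  eventually-bounded : (x : ℝ) →
    ∃[ B ] (0ℚ ℚ.< B × ∃[ N ] (∀ n → N ℕ.≤ n → ∣ seq x n ∣ ℚ.≤ B))
  eventually-bounded x with cauchy x 1ℚ (ℚ.positive⁻¹ 1ℚ)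
  ... | N , near = 1ℚ ℚ.+ ∣ seq x N ∣
      , ℚ.+-mono-<-≤ (ℚ.positive⁻¹ 1ℚ) (ℚ.0≤∣p∣ (seq x N))
      , N , bound
    where
    open +-*-Solver
    bound : ∀ n → N ℕ.≤ n → ∣ seq x n ∣ ℚ.≤ 1ℚ ℚ.+ ∣ seq x N ∣
    bound n N≤n = subst (λ p → ∣ p ∣ ℚ.≤ 1ℚ ℚ.+ ∣ seq x N ∣)
      (solve 2 (λ p q → (p :- q) :+ q := p) refl (seq x n) (seq x N))
      (ℚ.≤-trans (ℚ.∣p+q∣≤∣p∣+∣q∣ (seq x n ℚ.- seq x N) (seq x N))
        (ℚ.+-monoˡ-≤ ∣ seq x N ∣ (ℚ.<⇒≤ (near n N N≤n ℕ.≤-refl))))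

  ≤-+ʳ : ∀ {p A C} → 0ℚ ℚ.< C → p ℚ.≤ A → p ℚ.≤ A ℚ.+ C
  ≤-+ʳ {p} {A} {C} C>0 p≤A = subst (ℚ._≤ A ℚ.+ C) (ℚ.+-identityʳ p)
    (ℚ.+-mono-≤ p≤A (ℚ.<⇒≤ C>0))

  ≤-+ˡ : ∀ {p A C} → 0ℚ ℚ.< A → p ℚ.≤ C → p ℚ.≤ A ℚ.+ C
  ≤-+ˡ {p} {A} {C} A>0 p≤C = subst (ℚ._≤ A ℚ.+ C) (ℚ.+-identityˡ p)
    (ℚ.+-mono-≤ (ℚ.<⇒≤ A>0) p≤C)

  common-bound : (x y : ℝ) →
    ∃[ B ] (0ℚ ℚ.< B × ∃[ N ] (∀ n → N ℕ.≤ n →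
      ∣ seq x n ∣ ℚ.≤ B × ∣ seq y n ∣ ℚ.≤ B))
  common-bound x y =
    let A , A>0 , M , x≤A = eventually-bounded x
        C , C>0 , N , y≤C = eventually-bounded y
    in A ℚ.+ C , ℚ.+-mono-< A>0 C>0 , M ℕ.⊔ N , λ n MN≤n →
      ≤-+ʳ {A = A} C>0 (x≤A n (ℕ.m⊔n≤o⇒m≤o M N MN≤n))
    , ≤-+ˡ {C = C} A>0 (y≤C n (ℕ.m⊔n≤o⇒n≤o M N MN≤n))

infixl 6 _+ᴿ_
infixl 7 _*ᴿ_
infix  8 -ᴿ_

fromℚ : ℚ → ℝ
fromℚ q = mkℝ (λ _ → q) λ ε ε>0 →
  0 , λ _ _ _ _ → subst (ℚ._< ε) (sym (∣p-p∣≡0 q)) ε>0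

_+ᴿ_ : ℝ → ℝ → ℝ
x +ᴿ y = mkℝ (λ n → seq x n ℚ.+ seq y n) λ ε ε>0 →
  let M , xs = cauchy x (ε ℚ.* ½) (half-pos ε>0)
      N , ys = cauchy y (ε ℚ.* ½) (half-pos ε>0)
  in M ℕ.⊔ N , λ m n ≤m ≤n →
    +-estimate (seq x m) (seq y m) (seq x n) (seq y n) ε
      (xs m n (ℕ.m⊔n≤o⇒m≤o M N ≤m) (ℕ.m⊔n≤o⇒m≤o M N ≤n))
      (ys m n (ℕ.m⊔n≤o⇒n≤o M N ≤m) (ℕ.m⊔n≤o⇒n≤o M N ≤n))

-ᴿ_ : ℝ → ℝ
-ᴿ x = mkℝ (λ n → ℚ.- seq x n) λ ε ε>0 →
  let N , xs = cauchy x ε ε>0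
  in N , λ m n ≤m ≤n → -‿estimate (seq x m) (seq x n) ε (xs m n ≤m ≤n)

_*ᴿ_ : ℝ → ℝ → ℝ
x *ᴿ y = mkℝ (λ n → seq x n ℚ.* seq y n) λ ε ε>0 →
  let B , B>0 , L , bd = common-bound x y
      M , xs = cauchy x (scale B B>0 ε) (scale-pos B B>0 ε>0)
      N , ys = cauchy y (scale B B>0 ε) (scale-pos B B>0 ε>0)
  in L ℕ.⊔ (M ℕ.⊔ N) , λ m n ≤m ≤n →
    let xm≤B , _    = bd m (ℕ.m⊔n≤o⇒m≤o L (M ℕ.⊔ N) ≤m)
        _    , yn≤B = bd n (ℕ.m⊔n≤o⇒m≤o L (M ℕ.⊔ N) ≤n)
        MN≤m = ℕ.m⊔n≤o⇒n≤o L (M ℕ.⊔ N) ≤m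
        MN≤n = ℕ.m⊔n≤o⇒n≤o L (M ℕ.⊔ N) ≤n
    in *-estimate B B>0 (seq x m) (seq y m) (seq x n) (seq y n) ε xm≤B yn≤B
      (xs m n (ℕ.m⊔n≤o⇒m≤o M N MN≤m) (ℕ.m⊔n≤o⇒m≤o M N MN≤n))
      (ys m n (ℕ.m⊔n≤o⇒n≤o M N MN≤m) (ℕ.m⊔n≤o⇒n≤o M N MN≤n))

≗⇒≃ : ∀ {x y} → (∀ n → seq x n ≡ seq y n) → x ≃ y
≗⇒≃ {x} {y} x≗y = mk≃ λ ε ε>0 → 0 , λ n _ →
  subst (ℚ._< ε)
    (sym (trans (cong (λ p → ∣ p ℚ.- seq y n ∣) (x≗y n)) (∣p-p∣≡0 (seq y n))))
    ε>0

private
  ≃-refl : ∀ {x} → x ≃ x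
  ≃-refl {x} = ≗⇒≃ λ _ → refl

  ≃-sym : ∀ {x y} → x ≃ y → y ≃ x
  ≃-sym {x} {y} x≃y = mk≃ λ ε ε>0 →
    let N , xy = close x≃y ε ε>0
    in N , λ n ≤n → subst (ℚ._< ε) (∣p-q∣≡∣q-p∣ (seq x n) (seq y n)) (xy n ≤n)

  ≃-trans : ∀ {x y z} → x ≃ y → y ≃ z → x ≃ z
  ≃-trans {x} {y} {z} x≃y y≃z = mk≃ λ ε ε>0 →
    let M , xy = close x≃y (ε ℚ.* ½) (half-pos ε>0)
        N , yz = close y≃z (ε ℚ.* ½) (half-pos ε>0)
    in M ℕ.⊔ N , λ n ≤n → subst (λ p → ∣ p ∣ ℚ.< ε)
      (solve 3 (λ x y z → (x :- y) :+ (y :- z) := x :- z) refl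
        (seq x n) (seq y n) (seq z n))
      (sum-small (seq x n ℚ.- seq y n) (seq y n ℚ.- seq z n) ε
        (xy n (ℕ.m⊔n≤o⇒m≤o M N ≤n)) (yz n (ℕ.m⊔n≤o⇒n≤o M N ≤n)))
    where open +-*-Solver

  +ᴿ-cong : ∀ {x y u v} → x ≃ y → u ≃ v → x +ᴿ u ≃ y +ᴿ v
  +ᴿ-cong {x} {y} {u} {v} x≃y u≃v = mk≃ λ ε ε>0 →
    let M , xy = close x≃y (ε ℚ.* ½) (half-pos ε>0)
        N , uv = close u≃v (ε ℚ.* ½) (half-pos ε>0)
    in M ℕ.⊔ N , λ n ≤n →
      +-estimate (seq x n) (seq u n) (seq y n) (seq v n) ε
        (xy n (ℕ.m⊔n≤o⇒m≤o M N ≤n)) (uv n (ℕ.m⊔n≤o⇒n≤o M N ≤n))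

  -ᴿ-cong : ∀ {x y} → x ≃ y → -ᴿ x ≃ -ᴿ y
  -ᴿ-cong {x} {y} x≃y = mk≃ λ ε ε>0 →
    let N , xy = close x≃y ε ε>0
    in N , λ n ≤n → -‿estimate (seq x n) (seq y n) ε (xy n ≤n)

  *ᴿ-cong : ∀ {x y u v} → x ≃ y → u ≃ v → x *ᴿ u ≃ y *ᴿ v
  *ᴿ-cong {x} {y} {u} {v} x≃y u≃v = mk≃ λ ε ε>0 →
    let B , B>0 , L , bd = common-bound x v
        M , xy = close x≃y (scale B B>0 ε) (scale-pos B B>0 ε>0)
        N , uv = close u≃v (scale B B>0 ε) (scale-pos B B>0 ε>0)
    in L ℕ.⊔ (M ℕ.⊔ N) , λ n ≤n →
      let x≤B , v≤B = bd n (ℕ.m⊔n≤o⇒m≤o L (M ℕ.⊔ N) ≤n)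
          MN≤n = ℕ.m⊔n≤o⇒n≤o L (M ℕ.⊔ N) ≤n
      in *-estimate B B>0 (seq x n) (seq u n) (seq y n) (seq v n) ε x≤B v≤B
        (xy n (ℕ.m⊔n≤o⇒m≤o M N MN≤n)) (uv n (ℕ.m⊔n≤o⇒n≤o M N MN≤n))

  +ᴿ-assoc : ∀ x y z → (x +ᴿ y) +ᴿ z ≃ x +ᴿ (y +ᴿ z)
  +ᴿ-assoc x y z = ≗⇒≃ λ n → ℚ.+-assoc (seq x n) (seq y n) (seq z n)

  +ᴿ-identityˡ : ∀ x → fromℚ 0ℚ +ᴿ x ≃ x
  +ᴿ-identityˡ x = ≗⇒≃ λ n → ℚ.+-identityˡ (seq x n)

  +ᴿ-identityʳ : ∀ x → x +ᴿ fromℚ 0ℚ ≃ x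
  +ᴿ-identityʳ x = ≗⇒≃ λ n → ℚ.+-identityʳ (seq x n)

  -ᴿ-inverseˡ : ∀ x → -ᴿ x +ᴿ x ≃ fromℚ 0ℚ
  -ᴿ-inverseˡ x = ≗⇒≃ λ n → ℚ.+-inverseˡ (seq x n)

  -ᴿ-inverseʳ : ∀ x → x +ᴿ -ᴿ x ≃ fromℚ 0ℚ
  -ᴿ-inverseʳ x = ≗⇒≃ λ n → ℚ.+-inverseʳ (seq x n)

  +ᴿ-comm : ∀ x y → x +ᴿ y ≃ y +ᴿ x
  +ᴿ-comm x y = ≗⇒≃ λ n → ℚ.+-comm (seq x n) (seq y n)

  *ᴿ-assoc : ∀ x y z → (x *ᴿ y) *ᴿ z ≃ x *ᴿ (y *ᴿ z)
  *ᴿ-assoc x y z = ≗⇒≃ λ n → ℚ.*-assoc (seq x n) (seq y n) (seq z n)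

  *ᴿ-identityˡ : ∀ x → fromℚ 1ℚ *ᴿ x ≃ x
  *ᴿ-identityˡ x = ≗⇒≃ λ n → ℚ.*-identityˡ (seq x n)

  *ᴿ-identityʳ : ∀ x → x *ᴿ fromℚ 1ℚ ≃ x
  *ᴿ-identityʳ x = ≗⇒≃ λ n → ℚ.*-identityʳ (seq x n)

  *ᴿ-distribˡ-+ᴿ : ∀ x y z → x *ᴿ (y +ᴿ z) ≃ x *ᴿ y +ᴿ x *ᴿ z
  *ᴿ-distribˡ-+ᴿ x y z = ≗⇒≃ λ n →
    ℚ.*-distribˡ-+ (seq x n) (seq y n) (seq z n)

  *ᴿ-distribʳ-+ᴿ : ∀ x y z → (y +ᴿ z) *ᴿ x ≃ y *ᴿ x +ᴿ z *ᴿ x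
  *ᴿ-distribʳ-+ᴿ x y z = ≗⇒≃ λ n →
    ℚ.*-distribʳ-+ (seq x n) (seq y n) (seq z n)

  *ᴿ-comm : ∀ x y → x *ᴿ y ≃ y *ᴿ x
  *ᴿ-comm x y = ≗⇒≃ λ n → ℚ.*-comm (seq x n) (seq y n)

ℝ-commutativeRing : CommutativeRing 0ℓ 0ℓ
ℝ-commutativeRing = record
  { Carrier = ℝ
  ; _≈_     = _≃_
  ; _+_     = _+ᴿ_
  ; _*_     = _*ᴿ_
  ; -_      = -ᴿ_
  ; 0#      = fromℚ 0ℚ
  ; 1#      = fromℚ 1ℚ
  ; isCommutativeRing = record
    { isRing = record
      { +-isAbelianGroup = record
        { isGroup = record
          { isMonoid = record
            { isSemigroup = record
              { isMagma = record
                { isEquivalence = record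
                  { refl  = ≃-refl
                  ; sym   = ≃-sym
                  ; trans = ≃-trans
                  }
                ; ∙-cong = +ᴿ-cong
                }
              ; assoc = +ᴿ-assoc
              }
            ; identity = +ᴿ-identityˡ , +ᴿ-identityʳ
            }
          ; inverse = -ᴿ-inverseˡ , -ᴿ-inverseʳ
          ; ⁻¹-cong = -ᴿ-cong
          }
        ; comm = +ᴿ-comm
        }
      ; *-cong     = *ᴿ-cong
      ; *-assoc    = *ᴿ-assoc
      ; *-identity = *ᴿ-identityˡ , *ᴿ-identityʳ
      ; distrib    = *ᴿ-distribˡ-+ᴿ , *ᴿ-distribʳ-+ᴿ
      }
    ; *-comm = *ᴿ-comm
    }
  }

------------------------------------------------------------------------
-- K[i] = K[X]/(X² + 1) as pairs (re , im).  Stated for any commutative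
-- ring K because the solver needs the operations of K to be opaque.

module Adjoin-i (K : CommutativeRing 0ℓ 0ℓ) where
  private
    open CommutativeRing K
      using (Carrier; _≈_; _+_; _*_; _-_; -_; 0#; 1#; commutativeSemiring)
    open SemiringSolver commutativeSemiring
      using (solve; _:=_; _:+_; _:*_)
    module K = CommutativeRing K

  infix 4 _≈ᶜ_

  record Pair : Set where
    constructor _+i_
    field
      re : Carrier
      im : Carrier

  open Pair public

  record _≈ᶜ_ (z w : Pair) : Set where
    constructor _,_
    field
      re-≈ : re z ≈ re w
      im-≈ : im z ≈ im w

  private
    open RingProperties K.ring using (-1*x≈-x; -0#≈0#)

    -- A semiring solver suffices once x - y is rewritten as x + j * y, with
    -- j = - 1# treated as a variable.
    sub : ∀ x y → x - y ≈ x + - 1# * y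
    sub x y = K.+-congˡ (K.sym (-1*x≈-x y))

    sub′ : ∀ {x x′ y y′} → x ≈ x′ → y ≈ y′ → x - y ≈ x′ + - 1# * y′
    sub′ {x′ = x′} {y′ = y′} p q = K.trans (K.+-cong p (K.-‿cong q)) (sub x′ y′)

    *-assoc-re-j : ∀ j a b c d e f →
      (a * c + j * (b * d)) * e + j * ((a * d + b * c) * f) ≈
      a * (c * e + j * (d * f)) + j * (b * (c * f + d * e))
    *-assoc-re-j = solve 7 (λ j a b c d e f →
      (a :* c :+ j :* (b :* d)) :* e :+ j :* ((a :* d :+ b :* c) :* f) :=
      a :* (c :* e :+ j :* (d :* f)) :+ j :* (b :* (c :* f :+ d :* e))) K.refl

    *-assoc-re : ∀ a b c d e f →
      (a * c - b * d) * e - (a * d + b * c) * f ≈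
      a * (c * e - d * f) - b * (c * f + d * e)
    *-assoc-re a b c d e f =
      K.trans (sub′ (K.*-congʳ (sub (a * c) (b * d))) K.refl)
        (K.trans (*-assoc-re-j (- 1#) a b c d e f)
          (K.sym (sub′ (K.*-congˡ (sub (c * e) (d * f))) K.refl)))

    *-assoc-im-j : ∀ j a b c d e f →
      (a * c + j * (b * d)) * f + (a * d + b * c) * e ≈
      a * (c * f + d * e) + b * (c * e + j * (d * f))
    *-assoc-im-j = solve 7 (λ j a b c d e f →
      (a :* c :+ j :* (b :* d)) :* f :+ (a :* d :+ b :* c) :* e :=
      a :* (c :* f :+ d :* e) :+ b :* (c :* e :+ j :* (d :* f))) K.refl

    *-assoc-im : ∀ a b c d e f →
      (a * c - b * d) * f + (a * d + b * c) * e ≈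
      a * (c * f + d * e) + b * (c * e - d * f)
    *-assoc-im a b c d e f =
      K.trans (K.+-congʳ (K.*-congʳ (sub (a * c) (b * d))))
        (K.trans (*-assoc-im-j (- 1#) a b c d e f)
          (K.sym (K.+-congˡ (K.*-congˡ (sub (c * e) (d * f))))))

    x-0≈x : ∀ {x y z} → x ≈ z → y ≈ 0# → x - y ≈ z
    x-0≈x p q = K.trans (K.+-cong p (K.trans (K.-‿cong q) -0#≈0#)) (K.+-identityʳ _)

    *-identityˡ-re : ∀ a b → 1# * a - 0# * b ≈ a
    *-identityˡ-re a b = x-0≈x (K.*-identityˡ a) (K.zeroˡ b)

    *-identityˡ-im : ∀ a b → 1# * b + 0# * a ≈ b
    *-identityˡ-im a b =
      K.trans (K.+-cong (K.*-identityˡ b) (K.zeroˡ a)) (K.+-identityʳ b)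

    *-comm-re : ∀ a b c d → a * c - b * d ≈ c * a - d * b
    *-comm-re a b c d = K.+-cong (K.*-comm a c) (K.-‿cong (K.*-comm b d))

    *-comm-im : ∀ a b c d → a * d + b * c ≈ c * b + d * a
    *-comm-im = solve 4 (λ a b c d →
      a :* d :+ b :* c := c :* b :+ d :* a) K.refl

    *-identityʳ-re : ∀ a b → a * 1# - b * 0# ≈ a
    *-identityʳ-re a b = x-0≈x (K.*-identityʳ a) (K.zeroʳ b)

    *-identityʳ-im : ∀ a b → a * 0# + b * 1# ≈ b
    *-identityʳ-im a b =
      K.trans (K.+-cong (K.zeroʳ a) (K.*-identityʳ b)) (K.+-identityˡ b)

    distribˡ-re-j : ∀ j a b c d e f →
      a * (c + e) + j * (b * (d + f)) ≈
      (a * c + j * (b * d)) + (a * e + j * (b * f))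
    distribˡ-re-j = solve 7 (λ j a b c d e f →
      a :* (c :+ e) :+ j :* (b :* (d :+ f)) :=
      (a :* c :+ j :* (b :* d)) :+ (a :* e :+ j :* (b :* f))) K.refl

    distribˡ-re : ∀ a b c d e f →
      a * (c + e) - b * (d + f) ≈ (a * c - b * d) + (a * e - b * f)
    distribˡ-re a b c d e f =
      K.trans (sub (a * (c + e)) (b * (d + f)))
        (K.trans (distribˡ-re-j (- 1#) a b c d e f)
          (K.sym (K.+-cong (sub (a * c) (b * d)) (sub (a * e) (b * f)))))

    distribˡ-im : ∀ a b c d e f →
      a * (d + f) + b * (c + e) ≈ (a * d + b * c) + (a * f + b * e)
    distribˡ-im = solve 6 (λ a b c d e f →
      a :* (d :+ f) :+ b :* (c :+ e) := (a :* d :+ b :* c) :+ (a :* f :+ b :* e)) K.refl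

    distribʳ-re-j : ∀ j a b c d e f →
      (c + e) * a + j * ((d + f) * b) ≈
      (c * a + j * (d * b)) + (e * a + j * (f * b))
    distribʳ-re-j = solve 7 (λ j a b c d e f →
      (c :+ e) :* a :+ j :* ((d :+ f) :* b) :=
      (c :* a :+ j :* (d :* b)) :+ (e :* a :+ j :* (f :* b))) K.refl

    distribʳ-re : ∀ a b c d e f →
      (c + e) * a - (d + f) * b ≈ (c * a - d * b) + (e * a - f * b)
    distribʳ-re a b c d e f =
      K.trans (sub ((c + e) * a) ((d + f) * b))
        (K.trans (distribʳ-re-j (- 1#) a b c d e f)
          (K.sym (K.+-cong (sub (c * a) (d * b)) (sub (e * a) (f * b)))))

    distribʳ-im : ∀ a b c d e f →
      (c + e) * b + (d + f) * a ≈ (c * b + d * a) + (e * b + f * a)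
    distribʳ-im = solve 6 (λ a b c d e f →
      (c :+ e) :* b :+ (d :+ f) :* a := (c :* b :+ d :* a) :+ (e :* b :+ f :* a)) K.refl

  commutativeRing : CommutativeRing 0ℓ 0ℓ
  commutativeRing = record
    { Carrier = Pair
    ; _≈_     = _≈ᶜ_
    ; _+_     = λ z w → (re z + re w) +i (im z + im w)
    ; _*_     = λ z w → (re z * re w - im z * im w) +i (re z * im w + im z * re w)
    ; -_      = λ z → (- re z) +i (- im z)
    ; 0#      = 0# +i 0#
    ; 1#      = 1# +i 0#
    ; isCommutativeRing = record
      { isRing = record
        { +-isAbelianGroup = record
          { isGroup = record
            { isMonoid = record
              { isSemigroup = record
                { isMagma = record
                  { isEquivalence = record
                    { refl  = K.refl , K.refl
                    ; sym   = λ (p , q) → K.sym p , K.sym q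
                    ; trans = λ (p , q) (r , s) → K.trans p r , K.trans q s
                    }
                  ; ∙-cong = λ (p , q) (r , s) → K.+-cong p r , K.+-cong q s
                  }
                ; assoc = λ (a +i b) (c +i d) (e +i f) →
                    K.+-assoc a c e , K.+-assoc b d f
                }
              ; identity = (λ (a +i b) → K.+-identityˡ a , K.+-identityˡ b)
                         , (λ (a +i b) → K.+-identityʳ a , K.+-identityʳ b)
              }
            ; inverse = (λ (a +i b) → K.-‿inverseˡ a , K.-‿inverseˡ b)
                      , (λ (a +i b) → K.-‿inverseʳ a , K.-‿inverseʳ b)
            ; ⁻¹-cong = λ (p , q) → K.-‿cong p , K.-‿cong q
            }
          ; comm = λ (a +i b) (c +i d) → K.+-comm a c , K.+-comm b d
          }
        ; *-cong = λ (p , q) (r , s) →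
              K.+-cong (K.*-cong p r) (K.-‿cong (K.*-cong q s))
            , K.+-cong (K.*-cong p s) (K.*-cong q r)
        ; *-assoc = λ (a +i b) (c +i d) (e +i f) →
              *-assoc-re a b c d e f , *-assoc-im a b c d e f
        ; *-identity =
              (λ (a +i b) → *-identityˡ-re a b , *-identityˡ-im a b)
            , (λ (a +i b) → *-identityʳ-re a b , *-identityʳ-im a b)
        ; distrib =
              (λ (a +i b) (c +i d) (e +i f) →
                distribˡ-re a b c d e f , distribˡ-im a b c d e f)
            , (λ (a +i b) (c +i d) (e +i f) →
                distribʳ-re a b c d e f , distribʳ-im a b c d e f)
        }
      ; *-comm = λ (a +i b) (c +i d) → *-comm-re a b c d , *-comm-im a b c d
      }
    }

open Adjoin-i ℝ-commutativeRing public
  using (_+i_; re; im; _≈ᶜ_)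
  renaming (Pair to ℂ; commutativeRing to ℂ-commutativeRing)

open CommutativeRing ℂ-commutativeRing public
  using (_≈_; _+_; _*_; _-_; -_; 0#; 1#)

open SemiringExp (CommutativeRing.semiring ℂ-commutativeRing) public
  using (_^_)

open MonoidSum (CommutativeRing.+-monoid ℂ-commutativeRing) public
  using (sum; sum-syntax; sum⁺-syntax)

fromℕ : ℕ → ℂ
fromℕ n = n · 1#
  where
  open MonoidMult (CommutativeRing.+-monoid ℂ-commutativeRing)
    renaming (_×_ to _·_)

½ᶜ : ℂ
½ᶜ = fromℚ ½ +i fromℚ 0ℚ

------------------------------------------------------------------------

IsGeneralizedFibonacci : (ℤ → ℂ) → Set
IsGeneralizedFibonacci G =
  ∀ m → G (m ℤ.+ ℤ.+ 2) ≈ G (m ℤ.+ ℤ.+ 1) + G m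

{-# OPTIONS --safe #-}

-- Splitting G_{n+2-k} = G_{n+1-k} + G_{n-k} in a convolution c_n = Σ u_k G_{n-k}
-- gives c_{n+2} = c_{n+1} + c_n + u_{n+1} (G_1 - G_0) + u_{n+2} G_0 for every
-- weight u.  For u_k = (-1)^k k² G_k the right-hand side of the theorem obeys the
-- same recurrence, and the two sides agree for n = 0 and n = 1.

module Submission where

open import Algebra.Bundles using (CommutativeRing)
import Algebra.Properties.Monoid.Mult as MonoidMult
import Algebra.Properties.Monoid.Sum as MonoidSum
import Algebra.Properties.Ring as RingProperties
import Algebra.Properties.Semiring.Exp as SemiringExp
import Algebra.Properties.Semiring.Mult.TCOptimised as SemiringMult
import Algebra.Solver.Ring as RingSolver
open import Algebra.Solver.Ring.AlmostCommutativeRing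
  using (fromCommutativeRing; _-Raw-AlmostCommutative⟶_)
open import Data.Fin.Base using (Fin; toℕ)
open import Data.Fin.Properties using (toℕ≤pred[n])
open import Data.Integer.Base as ℤ using (ℤ; +_; +[1+_]; -[1+_]; _⊖_)
import Data.Integer.Properties as ℤ
open import Data.Maybe.Base using (map)
open import Data.Nat.Base as ℕ using (ℕ; zero; suc; _∸_)
import Data.Nat.Properties as ℕ
open import Function.Base using (_∘_)
open import Relation.Binary.PropositionalEquality as ≡ using (_≡_)
import Relation.Binary.Reasoning.Setoid as SetoidReasoning
open import Relation.Nullary.Decidable using (dec⇒maybe)

-- A ring solver with integer coefficients for any commutative ring.

module IntegerCoefficients {c ℓ} (R : CommutativeRing c ℓ) where
  open CommutativeRing R
  open RingProperties ring
  open SemiringMult semiring using (_×_; 1+×; ×-homo-+; ×1-homo-*)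
  open SetoidReasoning setoid

  -- With the optimised multiple `1 × 1#` is `1#` by definition, so the solver constants 0 and 1
  -- evaluate exactly to `0#` and `1#`.
  ⟦_⟧ℤ : ℤ → Carrier
  ⟦ + n ⟧ℤ      = n × 1#
  ⟦ -[1+ n ] ⟧ℤ = - (suc n × 1#)

  ⟦⟧ℤ-neg : ∀ i → ⟦ ℤ.- i ⟧ℤ ≈ - ⟦ i ⟧ℤ
  ⟦⟧ℤ-neg (+ zero)   = sym -0#≈0#
  ⟦⟧ℤ-neg +[1+ n ]   = refl
  ⟦⟧ℤ-neg -[1+ n ]   = sym (-‿involutive _)

  [z+x]-[z+y]≈x-y : ∀ x y z → (z + x) - (z + y) ≈ x - y
  [z+x]-[z+y]≈x-y x y z = begin
    (z + x) - (z + y)      ≈⟨ +-congˡ (-‿+-comm z y) ⟨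
    (z + x) + (- z + - y)  ≈⟨ +-congʳ (+-comm z x) ⟩
    (x + z) + (- z + - y)  ≈⟨ +-assoc x z _ ⟩
    x + (z + (- z + - y))  ≈⟨ +-congˡ (+-assoc z (- z) (- y)) ⟨
    x + ((z - z) + - y)    ≈⟨ +-congˡ (+-congʳ (-‿inverseʳ z)) ⟩
    x + (0# + - y)         ≈⟨ +-congˡ (+-identityˡ (- y)) ⟩
    x - y                  ∎

  ⟦⟧ℤ-⊖ : ∀ m n → ⟦ m ⊖ n ⟧ℤ ≈ m × 1# - n × 1#
  ⟦⟧ℤ-⊖ zero    zero    = sym (-‿inverseʳ 0#)
  ⟦⟧ℤ-⊖ zero    (suc n) = sym (+-identityˡ _)
  ⟦⟧ℤ-⊖ (suc m) zero    = sym (trans (+-congˡ -0#≈0#) (+-identityʳ _))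
  ⟦⟧ℤ-⊖ (suc m) (suc n) = begin
    ⟦ suc m ⊖ suc n ⟧ℤ             ≡⟨ ≡.cong ⟦_⟧ℤ (ℤ.[1+m]⊖[1+n]≡m⊖n m n) ⟩
    ⟦ m ⊖ n ⟧ℤ                     ≈⟨ ⟦⟧ℤ-⊖ m n ⟩
    m × 1# - n × 1#                ≈⟨ [z+x]-[z+y]≈x-y _ _ 1# ⟨
    (1# + m × 1#) - (1# + n × 1#)  ≈⟨ +-cong (1+× m 1#) (-‿cong (1+× n 1#)) ⟨
    suc m × 1# - suc n × 1#        ∎

  ⟦⟧ℤ-+ : ∀ i j → ⟦ i ℤ.+ j ⟧ℤ ≈ ⟦ i ⟧ℤ + ⟦ j ⟧ℤ
  ⟦⟧ℤ-+ (+ m)    (+ n)    = ×-homo-+ 1# m n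
  ⟦⟧ℤ-+ (+ m)    -[1+ n ] = ⟦⟧ℤ-⊖ m (suc n)
  ⟦⟧ℤ-+ -[1+ m ] (+ n)    = trans (⟦⟧ℤ-⊖ n (suc m)) (+-comm _ _)
  ⟦⟧ℤ-+ -[1+ m ] -[1+ n ] = begin
    - (suc (suc (m ℕ.+ n)) × 1#)     ≡⟨ ≡.cong (λ k → - (suc k × 1#)) (ℕ.+-suc m n) ⟨
    - ((suc m ℕ.+ suc n) × 1#)       ≈⟨ -‿cong (×-homo-+ 1# (suc m) (suc n)) ⟩
    - (suc m × 1# + suc n × 1#)      ≈⟨ -‿+-comm _ _ ⟨
    - (suc m × 1#) - (suc n × 1#)    ∎

  ⟦⟧ℤ-*-+ : ∀ m j → ⟦ + m ℤ.* j ⟧ℤ ≈ ⟦ + m ⟧ℤ * ⟦ j ⟧ℤ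
  ⟦⟧ℤ-*-+ m (+ n) = begin
    ⟦ + m ℤ.* + n ⟧ℤ     ≡⟨ ≡.cong ⟦_⟧ℤ (ℤ.pos-* m n) ⟨
    (m ℕ.* n) × 1#       ≈⟨ ×1-homo-* m n ⟩
    m × 1# * (n × 1#)    ∎
  ⟦⟧ℤ-*-+ m -[1+ n ] = begin
    ⟦ + m ℤ.* -[1+ n ] ⟧ℤ          ≡⟨ ≡.cong ⟦_⟧ℤ (ℤ.neg-distribʳ-* (+ m) +[1+ n ]) ⟨
    ⟦ ℤ.- (+ m ℤ.* +[1+ n ]) ⟧ℤ    ≈⟨ ⟦⟧ℤ-neg (+ m ℤ.* +[1+ n ]) ⟩
    - ⟦ + m ℤ.* +[1+ n ] ⟧ℤ        ≈⟨ -‿cong (⟦⟧ℤ-*-+ m +[1+ n ]) ⟩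
    - (m × 1# * (suc n × 1#))      ≈⟨ -‿distribʳ-* _ _ ⟩
    m × 1# * - (suc n × 1#)        ∎

  ⟦⟧ℤ-* : ∀ i j → ⟦ i ℤ.* j ⟧ℤ ≈ ⟦ i ⟧ℤ * ⟦ j ⟧ℤ
  ⟦⟧ℤ-* (+ m)    j = ⟦⟧ℤ-*-+ m j
  ⟦⟧ℤ-* -[1+ m ] j = begin
    ⟦ -[1+ m ] ℤ.* j ⟧ℤ          ≡⟨ ≡.cong ⟦_⟧ℤ (ℤ.neg-distribˡ-* +[1+ m ] j) ⟨
    ⟦ ℤ.- (+[1+ m ] ℤ.* j) ⟧ℤ    ≈⟨ ⟦⟧ℤ-neg (+[1+ m ] ℤ.* j) ⟩
    - ⟦ +[1+ m ] ℤ.* j ⟧ℤ        ≈⟨ -‿cong (⟦⟧ℤ-*-+ (suc m) j) ⟩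
    - (suc m × 1# * ⟦ j ⟧ℤ)      ≈⟨ -‿distribˡ-* _ _ ⟩
    - (suc m × 1#) * ⟦ j ⟧ℤ      ∎

  -- Equality in `R` is not assumed decidable; integer coefficients let the solver recognise
  -- cancellation.
  ⟦⟧ℤ-morphism : ℤ.+-*-rawRing -Raw-AlmostCommutative⟶ fromCommutativeRing R
  ⟦⟧ℤ-morphism = record
    { ⟦_⟧    = ⟦_⟧ℤ
    ; +-homo = ⟦⟧ℤ-+
    ; *-homo = ⟦⟧ℤ-*
    ; -‿homo = ⟦⟧ℤ-neg
    ; 0-homo = refl
    ; 1-homo = refl
    }

  open RingSolver ℤ.+-*-rawRing (fromCommutativeRing R) ⟦⟧ℤ-morphism
    (λ i j → map (reflexive ∘ ≡.cong ⟦_⟧ℤ) (dec⇒maybe (i ℤ.≟ j)))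
    public

-- Convolutions with a Fibonacci sequence.

module FibonacciConvolution {c ℓ} (R : CommutativeRing c ℓ) where
  open CommutativeRing R
  open SemiringExp semiring using (_^_)
  open MonoidMult +-monoid using (_×_)
  open MonoidSum +-monoid using (sum⁺-syntax)
  open IntegerCoefficients R
  open SetoidReasoning setoid

  convolution : (u g : ℕ → Carrier) → ℕ → Carrier
  convolution u g n = ∑[ k ≤ n ] (u (toℕ k) * g (n ∸ toℕ k))

  signedSquareWeight : (ℕ → Carrier) → ℕ → Carrier
  signedSquareWeight g k = (- 1#) ^ k * (k × 1#) ^ 2 * g k

  private
    one nil : ∀ {m} → Polynomial m
    one = con ℤ.1ℤ
    nil = con ℤ.0ℤ

    -- Solver syntax for `closedForm`, shaped to evaluate to it by definition; `one :+ (one :+ nil)`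
    -- is the unfolding of `2 × 1#`.
    closedFormᵖ : ∀ {m} (a b h e N x y : Polynomial m) → Polynomial m
    closedFormᵖ a b h e N x y =
      e :* h :* N :*
        ( ((N :- one) :* a :- (N :+ one) :* b) :* x
        :+ ((N :- one) :* a :+ (one :+ (one :+ nil)) :* b) :* y )
      :- (one :+ e) :* (b :* x :- a :* y)

  module _ (g : ℕ → Carrier) (fib : ∀ n → g (suc (suc n)) ≈ g (suc n) + g n) where

    convolution-rec : ∀ u n →
      convolution u g (suc (suc n)) ≈
      convolution u g (suc n) + convolution u g n
        + (u (suc n) * (g 1 - g 0) + u (suc (suc n)) * g 0)
    convolution-rec u zero = begin
      u 0 * g 2 + (u 1 * g 1 + (u 2 * g 0 + 0#))
        ≈⟨ +-congʳ (*-congˡ (fib 0)) ⟩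
      u 0 * (g 1 + g 0) + (u 1 * g 1 + (u 2 * g 0 + 0#))
        ≈⟨ solve 5 (λ u₀ u₁ u₂ a b →
             u₀ :* (b :+ a) :+ (u₁ :* b :+ (u₂ :* a :+ nil)) :=
             (u₀ :* b :+ (u₁ :* a :+ nil)) :+ (u₀ :* a :+ nil)
               :+ (u₁ :* (b :- a) :+ u₂ :* a))
           refl (u 0) (u 1) (u 2) (g 0) (g 1) ⟩
      (u 0 * g 1 + (u 1 * g 0 + 0#)) + (u 0 * g 0 + 0#)
        + (u 1 * (g 1 - g 0) + u 2 * g 0) ∎
    convolution-rec u (suc n) = begin
      u 0 * g (3 ℕ.+ n) + convolution (u ∘ suc) g (2 ℕ.+ n)
        ≈⟨ +-cong (*-congˡ (fib (suc n))) (convolution-rec (u ∘ suc) n) ⟩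
      u 0 * (g (2 ℕ.+ n) + g (1 ℕ.+ n)) + (c₁ + c₀ + d)
        ≈⟨ solve 6 (λ u₀ x y c₀ c₁ d →
             u₀ :* (y :+ x) :+ (c₁ :+ c₀ :+ d) :=
             (u₀ :* y :+ c₁) :+ (u₀ :* x :+ c₀) :+ d)
           refl (u 0) (g (1 ℕ.+ n)) (g (2 ℕ.+ n)) c₀ c₁ d ⟩
      (u 0 * g (2 ℕ.+ n) + c₁) + (u 0 * g (1 ℕ.+ n) + c₀) + d ∎
      where
      c₀ = convolution (u ∘ suc) g n
      c₁ = convolution (u ∘ suc) g (suc n)
      d  = u (2 ℕ.+ n) * (g 1 - g 0) + u (3 ℕ.+ n) * g 0

    -- The closed form and its recurrence.

    module _ (h : Carrier) (h+h≈1 : h + h ≈ 1#) where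

      -- The variables stand for (-1)^n, n, G_n and G_{n+1}; freeing them turns the recurrence into
      -- a polynomial identity modulo `h + h - 1#`.
      closedForm : (e N x y : Carrier) → Carrier
      closedForm e N x y =
        e * h * N *
          ( ((N - 1#) * g 0 - (N + 1#) * g 1) * x
          + ((N - 1#) * g 0 + (2 × 1#) * g 1) * y )
        - (1# + e) * (g 1 * x - g 0 * y)

      closedForm-cong : ∀ e N {x x′ y y′} → x ≈ x′ → y ≈ y′ →
        closedForm e N x y ≈ closedForm e N x′ y′
      closedForm-cong e N x≈x′ y≈y′ = +-cong
        (*-congˡ (+-cong (*-congˡ x≈x′) (*-congˡ y≈y′)))
        (-‿cong (*-congˡ (+-cong (*-congˡ x≈x′) (-‿cong (*-congˡ y≈y′)))))

      -- The solver sees `h` as a free variable, so its identities carry an explicit multiple of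
      -- `h + h - 1#`, which is discarded here.
      drop-[2h-1] : ∀ z w → z + (h + h - 1#) * w ≈ z
      drop-[2h-1] z w = begin
        z + (h + h - 1#) * w  ≈⟨ +-congˡ (*-congʳ (+-congʳ h+h≈1)) ⟩
        z + (1# - 1#) * w     ≈⟨ +-congˡ (*-congʳ (-‿inverseʳ 1#)) ⟩
        z + 0# * w            ≈⟨ +-congˡ (zeroˡ w) ⟩
        z + 0#                ≈⟨ +-identityʳ z ⟩
        z                     ∎

      closedForm-1 : closedForm ((- 1#) ^ 1) (1 × 1#) (g 1) (g 1 + g 0) ≈
                     convolution (signedSquareWeight g) g 1
      closedForm-1 = begin
        closedForm ((- 1#) ^ 1) (1 × 1#) (g 1) (g 1 + g 0)
          -- At e = -1, N = 1 the closed form collapses to -2hab, while the convolution is -ab; the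
          -- excess is (2h - 1)(-ab).
          ≈⟨ solve 3 (λ a b h →
               let e = :- one :* one ; N = one :+ nil in
               closedFormᵖ a b h e N b (b :+ a) :=
               one :* (nil :* (nil :* one)) :* a :* b
                 :+ (e :* (N :* (N :* one)) :* b :* a :+ nil)
                 :+ (h :+ h :- one) :* (:- (a :* b)))
             refl (g 0) (g 1) h ⟩
        convolution (signedSquareWeight g) g 1 + (h + h - 1#) * (- (g 0 * g 1))
          ≈⟨ drop-[2h-1] _ _ ⟩
        convolution (signedSquareWeight g) g 1 ∎

      -- Write closedForm as h * P - Q and let w be the inhomogeneous term.  The defect
      -- of Q in the recurrence is 2eq, with q = g₁ y - g₀ (y + x), and that of P is
      -- 2 (w + 2eq); so the total defect exceeds w by (2h - 1) (w + 2eq).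
      closedForm-rec : ∀ e N x y →
        let e₁ = - 1# * e  ; e₂ = - 1# * e₁
            N₁ = 1# + N    ; N₂ = 1# + N₁
        in
        closedForm e₂ N₂ (y + x) ((y + x) + y) ≈
        closedForm e₁ N₁ y (y + x) + closedForm e N x y
          + (e₁ * N₁ ^ 2 * y * (g 1 - g 0) + e₂ * N₂ ^ 2 * (y + x) * g 0)
      closedForm-rec e N x y = trans
        (solve 7 (λ e N x y a b h →
          let e₁ = :- one :* e ; e₂ = :- one :* e₁
              N₁ = one :+ N    ; N₂ = one :+ N₁
              F  = closedFormᵖ a b h
              w  = e₁ :* (N₁ :* (N₁ :* one)) :* y :* (b :- a)
                     :+ e₂ :* (N₂ :* (N₂ :* one)) :* (y :+ x) :* a
              q  = b :* y :- a :* (y :+ x)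
          in
          F e₂ N₂ (y :+ x) ((y :+ x) :+ y) :=
          F e₁ N₁ y (y :+ x) :+ F e N x y :+ w
            :+ (h :+ h :- one) :* (w :+ (e :* q :+ e :* q)))
        refl e N x y (g 0) (g 1) h)
        (drop-[2h-1] _ _)

      convolution≈closedForm : ∀ n →
        convolution (signedSquareWeight g) g n ≈
        closedForm ((- 1#) ^ n) (n × 1#) (g n) (g (suc n))
      -- Both sides vanish: the weight and `N` are zero, and `g 1 * g 0 - g 0 * g 1` cancels.
      convolution≈closedForm zero = solve 3 (λ a b h →
        one :* (nil :* (nil :* one)) :* a :* a :+ nil :=
        closedFormᵖ a b h one nil a b)
        refl (g 0) (g 1) h
      convolution≈closedForm (suc zero) = begin
        convolution (signedSquareWeight g) g 1
          ≈⟨ closedForm-1 ⟨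
        closedForm ((- 1#) ^ 1) (1 × 1#) (g 1) (g 1 + g 0)
          ≈⟨ closedForm-cong _ _ refl (fib 0) ⟨
        closedForm ((- 1#) ^ 1) (1 × 1#) (g 1) (g 2) ∎
      convolution≈closedForm (suc (suc n)) = begin
        convolution (signedSquareWeight g) g (2 ℕ.+ n)
          ≈⟨ convolution-rec (signedSquareWeight g) n ⟩
        convolution (signedSquareWeight g) g (1 ℕ.+ n) + convolution (signedSquareWeight g) g n
          + (s₁ * y * (g 1 - g 0) + s₂ * g (2 ℕ.+ n) * g 0)
          ≈⟨ +-cong
               (+-cong (trans (convolution≈closedForm (suc n)) (closedForm-cong _ _ refl (fib n)))
                 (convolution≈closedForm n))
               (+-congˡ (*-congʳ (*-congˡ (fib n)))) ⟩
        closedForm ((- 1#) ^ (1 ℕ.+ n)) ((1 ℕ.+ n) × 1#) y (y + x)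
          + closedForm ((- 1#) ^ n) (n × 1#) x y
          + (s₁ * y * (g 1 - g 0) + s₂ * (y + x) * g 0)
          -- The successor powers and multiples unfold by definition to the `e₁`, `e₂`, `N₁`, `N₂`
          -- of `closedForm-rec`.
          ≈⟨ closedForm-rec ((- 1#) ^ n) (n × 1#) x y ⟨
        closedForm ((- 1#) ^ (2 ℕ.+ n)) ((2 ℕ.+ n) × 1#) (y + x) ((y + x) + y)
          ≈⟨ closedForm-cong _ _ (fib n) (trans (fib (suc n)) (+-congʳ (fib n))) ⟨
        closedForm ((- 1#) ^ (2 ℕ.+ n)) ((2 ℕ.+ n) × 1#) (g (2 ℕ.+ n)) (g (3 ℕ.+ n)) ∎
        where
        x = g n
        y = g (suc n)
        s₁ = (- 1#) ^ (1 ℕ.+ n) * ((1 ℕ.+ n) × 1#) ^ 2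
        s₂ = (- 1#) ^ (2 ℕ.+ n) * ((2 ℕ.+ n) × 1#) ^ 2

-- The theorem as a record over the operations it mentions: two instances of a
-- record type are compared argument by argument, so passing from the operations
-- of ℂ-commutativeRing to their copies in Defs never unfolds complex arithmetic.
record WeightedConvolutionIdentity {c ℓ} {A : Set c}
  (_≈_ : A → A → Set ℓ) (_+_ _*_ _-_ : A → A → A) (-_ : A → A) (1# : A)
  (_^_ : A → ℕ → A) (fromℕ : ℕ → A) (∑≤ : ∀ n → (Fin (suc n) → A) → A)
  (½ : A) (G : ℤ → A) (n : ℕ) : Set ℓ where
  constructor mkIdentity
  field
    identity :
      ∑≤ n (λ k → (((((- 1#) ^ toℕ k) * (fromℕ (toℕ k) ^ 2)) * G (+ toℕ k)) * G (+ n ℤ.- + toℕ k)))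
      ≈ ((((((- 1#) ^ n) * ½) * fromℕ n) *
      ( ((((fromℕ n - 1#) * G (+ 0)) - ((fromℕ n + 1#) * G (+ 1))) * G (+ n))
      + ((((fromℕ n - 1#) * G (+ 0)) + (fromℕ 2 * G (+ 1))) * G (+ suc n)) ))
      - ((1# + ((- 1#) ^ n)) * ((G (+ 1) * G (+ n)) - (G (+ 0) * G (+ suc n)))))

open WeightedConvolutionIdentity

-- From integer indices to natural ones.

m-n≡m∸n : ∀ {m n} → n ℕ.≤ m → + m ℤ.- + n ≡ + (m ∸ n)
m-n≡m∸n {m} {n} n≤m = ≡.trans (ℤ.m-n≡m⊖n m n) (ℤ.⊖-≥ n≤m)

module _ {c ℓ} (R : CommutativeRing c ℓ) where
  open CommutativeRing R
  open SemiringExp semiring using (_^_)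
  open MonoidMult +-monoid using (_×_)
  open MonoidSum +-monoid using (sum-cong-≋; sum⁺-syntax)
  open FibonacciConvolution R

  weightedConvolutionIdentity :
    (G : ℤ → Carrier) → (∀ m → G (m ℤ.+ + 2) ≈ G (m ℤ.+ + 1) + G m) →
    (½ : Carrier) → ½ + ½ ≈ 1# → (n : ℕ) →
    WeightedConvolutionIdentity _≈_ _+_ _*_ _-_ -_ 1# _^_ (_× 1#) sum⁺-syntax ½ G n
  weightedConvolutionIdentity G G-fib ½ ½+½≈1 n = mkIdentity (trans
    -- Since `toℕ k ≤ n`, truncated subtraction gives the true index n - k, and only `G ∘ +_` is
    -- involved.
    (sum-cong-≋ {suc n} λ k →
      *-congˡ {signedSquareWeight (G ∘ +_) (toℕ k)}
        (reflexive (≡.cong G (m-n≡m∸n (toℕ≤pred[n] k)))))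
    (convolution≈closedForm (G ∘ +_) fib ½ ½+½≈1 n))
    where
    fib : ∀ m → G (+ suc (suc m)) ≈ G (+ suc m) + G (+ m)
    fib m = ≡.subst₂ (λ i j → G (+ i) ≈ G (+ j) + G (+ m))
      -- The indices of `G-fib` compute to `m ℕ.+ 2` and `m ℕ.+ 1`, which must be commuted into
      -- successors of `m`.
      (ℕ.+-comm m 2) (ℕ.+-comm m 1) (G-fib (+ m))

-- Specialisation to the complex numbers.

open import Defs

-- Both components are constant rational sequences, equal termwise by computation.
½ᶜ+½ᶜ≈1 : ½ᶜ + ½ᶜ ≈ 1#
½ᶜ+½ᶜ≈1 = record { re-≈ = ≗⇒≃ λ _ → ≡.refl ; im-≈ = ≗⇒≃ λ _ → ≡.refl }

complexIdentity : (G : ℤ → ℂ) → IsGeneralizedFibonacci G → (n : ℕ) →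
  WeightedConvolutionIdentity _≈_ _+_ _*_ _-_ -_ 1# _^_ fromℕ sum⁺-syntax ½ᶜ G n
complexIdentity G G-fib = weightedConvolutionIdentity ℂ-commutativeRing G G-fib ½ᶜ ½ᶜ+½ᶜ≈1

mainTheorem14 : (G : ℤ → ℂ) → IsGeneralizedFibonacci G → (n : ℕ) →
    ∑[ k ≤ n ] ((- 1#) ^ toℕ k * fromℕ (toℕ k) ^ 2 * G (+ toℕ k) * G (+ n ℤ.- + toℕ k))
    ≈ (- 1#) ^ n * ½ᶜ * fromℕ n *
    ( ((fromℕ n - 1#) * G (+ 0) - (fromℕ n + 1#) * G (+ 1)) * G (+ n)
    + ((fromℕ n - 1#) * G (+ 0) + fromℕ 2 * G (+ 1)) * G (+ suc n) )
    - (1# + (- 1#) ^ n) * (G (+ 1) * G (+ n) - G (+ 0) * G (+ suc n))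
mainTheorem14 G G-fib n = identity (complexIdentity G G-fib n)
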